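{- Let $n \in \mathbb{N}$ and let $p(z) = \sum_{k=0}^N a_k z^k \in \mathbb{Z}[z]$ be a nonzero polynomial with integer coefficients such that $(1-z)^n$ divides $p(z)$. Then \[ \sum_{k=0}^N |a_k|^2 \ge 2n. \]
   Context: $\mathbb{N}$ denotes the set of positive integers. -}

module Defs where

open import Algebra.Bundles.Raw using (RawRing)
import Algebra.Definitions.RawMonoid as RawMonoidDefs
import Algebra.Definitions.RawSemiring as RawSemiringDefs
open import Data.Fin.Base using (toℕ)
open import Data.Integer.Base as ℤ using (ℤ; 0ℤ; 1ℤ)
open import Data.List.Base using (List; []; _∷_; map)
open import Data.Nat.Base as ℕ using (ℕ; zero; suc)
open import Data.Vec.Functional using (Vector)
open import Level using (0ℓ)
open import Relation.Binary.PropositionalEquality using (_≡_)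

-- An element of ℤ[z] is a list of coefficients, constant term first.
-- Trailing zeros are allowed, so equality is _≈ₚ_, not _≡_.
ℤ[z] : Set
ℤ[z] = List ℤ

coeff : ℤ[z] → ℕ → ℤ
coeff []      _       = 0ℤ
coeff (x ∷ p) zero    = x
coeff (x ∷ p) (suc k) = coeff p k

infix  4 _≈ₚ_
infixl 6 _+ₚ_
infixl 7 _*ₚ_
infix  8 -ₚ_

_≈ₚ_ : ℤ[z] → ℤ[z] → Set
p ≈ₚ q = ∀ k → coeff p k ≡ coeff q k

_+ₚ_ : ℤ[z] → ℤ[z] → ℤ[z]
[]      +ₚ q       = q
(x ∷ p) +ₚ []      = x ∷ p
(x ∷ p) +ₚ (y ∷ q) = (x ℤ.+ y) ∷ (p +ₚ q)

-ₚ_ : ℤ[z] → ℤ[z]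
-ₚ_ = map (ℤ.-_)

-- (x + z p) q = x q + z (p q)
_*ₚ_ : ℤ[z] → ℤ[z] → ℤ[z]
[]      *ₚ q = []
(x ∷ p) *ₚ q = map (x ℤ.*_) q +ₚ (0ℤ ∷ (p *ₚ q))

ℤ[z]-rawRing : RawRing 0ℓ 0ℓ
ℤ[z]-rawRing = record
  { Carrier = ℤ[z]
  ; _≈_     = _≈ₚ_
  ; _+_     = _+ₚ_
  ; _*_     = _*ₚ_
  ; -_      = -ₚ_
  ; 0#      = []
  ; 1#      = 1ℤ ∷ []
  }

open RawRing ℤ[z]-rawRing public using (_≈_; _≉_; _+_; _*_; -_; 0#; 1#)
open RawSemiringDefs (RawRing.rawSemiring ℤ[z]-rawRing) public using (_∣_; _^_) renaming (sum to sumₚ)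
open RawMonoidDefs ℕ.+-0-rawMonoid public using () renaming (sum to sumℕ)

const : ℤ → ℤ[z]
const x = x ∷ []

z : ℤ[z]
z = 0ℤ ∷ 1ℤ ∷ []

polynomial : ∀ {m} → Vector ℤ m → ℤ[z]
polynomial a = sumₚ (λ k → const (a k) * z ^ toℕ k)

{-# OPTIONS --safe #-}

-- Let X and Y be the multisets of exponents occurring with positive and with
-- negative coefficients.  Divisibility by (1 - z)^n says that the power sums of
-- X and Y of degree < n agree, so by Newton's identities their elementary
-- symmetric functions of degree < n agree.  If |X| = |Y| < n, then X and Y are
-- the root multisets of one and the same polynomial, although they are disjoint.
-- Hence |X| = |Y| ≥ n, and ∑ |aₖ|² ≥ ∑ |aₖ| = |X| + |Y| ≥ 2n.

module Submission where

open import Defs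
open import Data.Integer.Base using (ℤ; ∣_∣)
open import Data.Nat.Base as ℕ using (ℕ; suc; _≤_; _≥_)
open import Data.Vec.Functional using (Vector)

open import Algebra.Definitions.RawMagma using (_,_)
open import Data.Empty using (⊥)
open import Data.Fin.Base using (toℕ)
import Data.Fin.Base as Fin
open import Data.Fin.Properties using (toℕ-injective)
open import Data.Integer.Base as ℤ using (+_; +[1+_]; -[1+_]; 0ℤ; 1ℤ; -1ℤ)
import Data.Integer.Properties as ℤ
open import Data.Integer.Tactic.RingSolver using (solve-∀)
open import Data.List.Base using (List; []; _∷_; _++_; concat; foldr; length; map; replicate; tabulate)
open import Data.List.Membership.Propositional using (_∈_)
open import Data.List.Membership.Propositional.Properties using (∈-map⁺; ∈-map⁻)
open import Data.List.Properties using (length-++; length-map; length-replicate)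
open import Data.List.Relation.Unary.Any using (here; there)
import Data.List.Relation.Unary.Any.Properties as Any
open import Data.Nat.Base using (zero; _<_; z≤n; s≤s)
import Data.Nat.Properties as ℕ
open import Algebra.Properties.CommutativeSemigroup ℕ.+-commutativeSemigroup using (interchange)
open import Data.Product.Base using (∃; _×_; _,_; proj₂)
open import Data.Sum.Base using (inj₁; inj₂)
open import Function.Base using (_∘_)
open import Level using (Level)
open import Relation.Binary.PropositionalEquality using (_≡_; _≢_; _≗_; refl; sym; trans; cong; cong₂; subst; module ≡-Reasoning)
open import Relation.Nullary.Decidable using (yes; no)
open import Relation.Nullary.Negation using (contradiction)

private
  variable
    ℓ : Level
    A B : Set ℓ
    m n : ℕ

-- Finite differences

Δ : (ℕ → ℤ) → ℕ → ℤ
Δ f k = f (suc k) ℤ.- f k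

-- Degree < n is expressed as the vanishing of the n-th difference.
data DegreeBelow : ℕ → (ℕ → ℤ) → Set where
  zeros : ∀ {f} → (∀ k → f k ≡ 0ℤ) → DegreeBelow 0 f
  diff  : ∀ {n f} → DegreeBelow n (Δ f) → DegreeBelow (suc n) f

DegreeBelow-cong : ∀ {f g} → f ≗ g → DegreeBelow n f → DegreeBelow n g
DegreeBelow-cong f≗g (zeros f≗0) = zeros λ k → trans (sym (f≗g k)) (f≗0 k)
DegreeBelow-cong f≗g (diff d)    = diff (DegreeBelow-cong (λ k → cong₂ ℤ._-_ (f≗g (suc k)) (f≗g k)) d)

DegreeBelow-suc : ∀ {f} → DegreeBelow n f → DegreeBelow (suc n) f
DegreeBelow-suc (zeros f≗0) = diff (zeros λ k → cong₂ ℤ._-_ (f≗0 (suc k)) (f≗0 k))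
DegreeBelow-suc (diff d)    = diff (DegreeBelow-suc d)

DegreeBelow-mono : ∀ {f} → m ≤ n → DegreeBelow m f → DegreeBelow n f
DegreeBelow-mono {n = zero}  z≤n       d        = d
DegreeBelow-mono {n = suc n} z≤n       d        = DegreeBelow-suc (DegreeBelow-mono z≤n d)
DegreeBelow-mono             (s≤s m≤n) (diff d) = diff (DegreeBelow-mono m≤n d)

DegreeBelow-shift : ∀ {f} → DegreeBelow n f → DegreeBelow n (f ∘ suc)
DegreeBelow-shift (zeros f≗0) = zeros (f≗0 ∘ suc)
DegreeBelow-shift (diff d)    = diff (DegreeBelow-shift d)

DegreeBelow-const : ∀ c → DegreeBelow (suc n) (λ _ → c)
DegreeBelow-const c = DegreeBelow-mono (s≤s z≤n) (diff (zeros λ _ → ℤ.i≡j⇒i-j≡0 {i = c} refl))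

DegreeBelow-+ : ∀ {f g} → DegreeBelow n f → DegreeBelow n g → DegreeBelow n (λ k → f k ℤ.+ g k)
DegreeBelow-+ (zeros f≗0) (zeros g≗0) = zeros λ k → cong₂ ℤ._+_ (f≗0 k) (g≗0 k)
DegreeBelow-+ {f = f} {g} (diff df) (diff dg) =
  diff (DegreeBelow-cong (λ k → lemma (f (suc k)) (f k) (g (suc k)) (g k)) (DegreeBelow-+ df dg))
  where
  lemma : ∀ a b c d → (a ℤ.- b) ℤ.+ (c ℤ.- d) ≡ (a ℤ.+ c) ℤ.- (b ℤ.+ d)
  lemma = solve-∀

DegreeBelow-neg : ∀ {f} → DegreeBelow n f → DegreeBelow n (λ k → ℤ.- f k)
DegreeBelow-neg (zeros f≗0) = zeros λ k → cong ℤ.-_ (f≗0 k)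
DegreeBelow-neg {f = f} (diff d) =
  diff (DegreeBelow-cong (λ k → lemma (f (suc k)) (f k)) (DegreeBelow-neg d))
  where
  lemma : ∀ a b → ℤ.- (a ℤ.- b) ≡ (ℤ.- a) ℤ.- (ℤ.- b)
  lemma = solve-∀

-- Leibniz rule: Δ(k f(k)) = k Δf(k) + Δf(k) + f(k). The first summand is bounded by recursion, the
-- others by the bounds on Δf and f.
DegreeBelow-id* : ∀ {f} → DegreeBelow n f → DegreeBelow (suc n) (λ k → + k ℤ.* f k)
DegreeBelow-id* (zeros f≗0) =
  DegreeBelow-suc (zeros λ k → trans (cong (+ k ℤ.*_) (f≗0 k)) (ℤ.*-zeroʳ (+ k)))
DegreeBelow-id* {f = f} d@(diff Δd) =
  diff (DegreeBelow-cong (λ k → leibniz (+ k) (f (suc k)) (f k))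
    (DegreeBelow-+ (DegreeBelow-id* Δd) (DegreeBelow-+ (DegreeBelow-suc Δd) d)))
  where
  leibniz : ∀ k a b → k ℤ.* (a ℤ.- b) ℤ.+ ((a ℤ.- b) ℤ.+ b) ≡ (1ℤ ℤ.+ k) ℤ.* a ℤ.- k ℤ.* b
  leibniz = solve-∀

-- Sums over lists and elementary symmetric functions

∑ : List A → (A → ℤ) → ℤ
∑ xs f = foldr (λ x s → f x ℤ.+ s) 0ℤ xs

∑-cong : ∀ (xs : List A) {f g} → f ≗ g → ∑ xs f ≡ ∑ xs g
∑-cong []       f≗g = refl
∑-cong (x ∷ xs) f≗g = cong₂ ℤ._+_ (f≗g x) (∑-cong xs f≗g)

∑-map : ∀ (g : A → B) xs f → ∑ (map g xs) f ≡ ∑ xs (f ∘ g)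
∑-map g []       f = refl
∑-map g (x ∷ xs) f = cong (λ s → f (g x) ℤ.+ s) (∑-map g xs f)

∑-++ : ∀ (xs ys : List A) f → ∑ (xs ++ ys) f ≡ ∑ xs f ℤ.+ ∑ ys f
∑-++ []       ys f = sym (ℤ.+-identityˡ _)
∑-++ (x ∷ xs) ys f = trans (cong (λ s → f x ℤ.+ s) (∑-++ xs ys f)) (sym (ℤ.+-assoc (f x) _ _))

∑-replicate : ∀ n (x : A) f → ∑ (replicate n x) f ≡ + n ℤ.* f x
∑-replicate zero    x f = sym (ℤ.*-zeroˡ (f x))
∑-replicate (suc n) x f = trans (cong (λ s → f x ℤ.+ s) (∑-replicate n x f)) (lemma (f x) (+ n))
  where
  lemma : ∀ a k → a ℤ.+ k ℤ.* a ≡ (1ℤ ℤ.+ k) ℤ.* a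
  lemma = solve-∀

∑-1 : ∀ (xs : List A) → ∑ xs (λ _ → 1ℤ) ≡ + length xs
∑-1 []       = refl
∑-1 (x ∷ xs) = cong (λ s → 1ℤ ℤ.+ s) (∑-1 xs)

∑-linear : ∀ (xs : List A) c f g → ∑ xs (λ x → f x ℤ.+ c ℤ.* g x) ≡ ∑ xs f ℤ.+ c ℤ.* ∑ xs g
∑-linear []       c f g = sym (trans (ℤ.+-identityˡ _) (ℤ.*-zeroʳ c))
∑-linear (x ∷ xs) c f g = trans (cong (λ s → (f x ℤ.+ c ℤ.* g x) ℤ.+ s) (∑-linear xs c f g))
  (lemma (f x) c (g x) (∑ xs f) (∑ xs g))
  where
  lemma : ∀ a c b s t → (a ℤ.+ c ℤ.* b) ℤ.+ (s ℤ.+ c ℤ.* t) ≡ (a ℤ.+ s) ℤ.+ c ℤ.* (b ℤ.+ t)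
  lemma = solve-∀

esym : ℕ → List ℤ → ℤ
esym zero    xs       = 1ℤ
esym (suc k) []       = 0ℤ
esym (suc k) (x ∷ xs) = esym (suc k) xs ℤ.+ x ℤ.* esym k xs

-- ∑ⱼ (-x)ʲ e₍ₖ₋ⱼ₎(xs).  If x ∈ xs, this is the k-th elementary symmetric function
-- of xs with one copy of x removed; in any case it is a polynomial of degree k in x.
esymErase : ℕ → List ℤ → ℤ → ℤ
esymErase zero    xs x = 1ℤ
esymErase (suc k) xs x = esym (suc k) xs ℤ.- x ℤ.* esymErase k xs x

-- The recursion of `esymErase` subtracts exactly the term that `esym` adds for the head.
esymErase-head : ∀ k x xs → esymErase k (x ∷ xs) x ≡ esym k xs
esymErase-head zero    x xs = refl
esymErase-head (suc k) x xs rewrite esymErase-head k x xs = lemma (esym (suc k) xs) (x ℤ.* esym k xs)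
  where
  lemma : ∀ a b → (a ℤ.+ b) ℤ.- b ≡ a
  lemma = solve-∀

-- `esymErase k xs x` is the coefficient of tᵏ in ∏ (1 + w t) / (1 + x t), with w ranging over `xs`;
-- adjoining `y` multiplies this series by 1 + y t.
esymErase-∷ : ∀ k y xs x → esymErase (suc k) (y ∷ xs) x ≡ esymErase (suc k) xs x ℤ.+ y ℤ.* esymErase k xs x
esymErase-∷ zero    y xs x = lemma (esym 1 xs) x y
  where
  lemma : ∀ a x y → (a ℤ.+ y ℤ.* 1ℤ) ℤ.- x ℤ.* 1ℤ ≡ (a ℤ.- x ℤ.* 1ℤ) ℤ.+ y ℤ.* 1ℤ
  lemma = solve-∀
esymErase-∷ (suc k) y xs x rewrite esymErase-∷ k y xs x =
  lemma (esym (suc (suc k)) xs) (esym (suc k) xs) x y (esymErase k xs x)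
  where
  lemma : ∀ a b x y d → (a ℤ.+ y ℤ.* b) ℤ.- x ℤ.* ((b ℤ.- x ℤ.* d) ℤ.+ y ℤ.* d)
                      ≡ (a ℤ.- x ℤ.* (b ℤ.- x ℤ.* d)) ℤ.+ y ℤ.* (b ℤ.- x ℤ.* d)
  lemma = solve-∀

-- Each squarefree monomial of degree k + 1 arises once for every choice of one of its k + 1 factors
-- as x. Unfolding `esymErase` gives Newton's identity in its usual form with power sums.
newton : ∀ k xs → ∑ xs (λ x → x ℤ.* esymErase k xs x) ≡ + suc k ℤ.* esym (suc k) xs
newton k       []       = sym (ℤ.*-zeroʳ (+ suc k))
newton zero    (y ∷ xs) = trans (cong (λ s → y ℤ.* 1ℤ ℤ.+ s) (newton zero xs)) (lemma y (esym 1 xs))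
  where
  lemma : ∀ y a → y ℤ.* 1ℤ ℤ.+ 1ℤ ℤ.* a ≡ 1ℤ ℤ.* (a ℤ.+ y ℤ.* 1ℤ)
  lemma = solve-∀
newton (suc k) (y ∷ xs) = begin
  y ℤ.* e' y ℤ.+ ∑ xs (λ x → x ℤ.* e' x)
    ≡⟨ cong₂ (λ a b → y ℤ.* a ℤ.+ b) (esymErase-head (suc k) y xs) (∑-cong xs expand) ⟩
  y ℤ.* esym (suc k) xs ℤ.+ ∑ xs (λ x → x ℤ.* esymErase (suc k) xs x ℤ.+ y ℤ.* (x ℤ.* esymErase k xs x))
    ≡⟨ cong (λ s → y ℤ.* esym (suc k) xs ℤ.+ s) (∑-linear xs y (λ x → x ℤ.* esymErase (suc k) xs x) (λ x → x ℤ.* esymErase k xs x)) ⟩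
  y ℤ.* esym (suc k) xs ℤ.+ (∑ xs (λ x → x ℤ.* esymErase (suc k) xs x) ℤ.+ y ℤ.* ∑ xs (λ x → x ℤ.* esymErase k xs x))
    ≡⟨ cong₂ (λ a b → y ℤ.* esym (suc k) xs ℤ.+ (a ℤ.+ y ℤ.* b)) (newton (suc k) xs) (newton k xs) ⟩
  y ℤ.* esym (suc k) xs ℤ.+ (+ suc (suc k) ℤ.* esym (suc (suc k)) xs ℤ.+ y ℤ.* (+ suc k ℤ.* esym (suc k) xs))
    ≡⟨ collect y (+ suc k) (esym (suc k) xs) (esym (suc (suc k)) xs) ⟩
  + suc (suc k) ℤ.* (esym (suc (suc k)) xs ℤ.+ y ℤ.* esym (suc k) xs) ∎
  where
  open ≡-Reasoning
  e' : ℤ → ℤ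
  e' = esymErase (suc k) (y ∷ xs)
  distribute : ∀ x a y b → x ℤ.* (a ℤ.+ y ℤ.* b) ≡ x ℤ.* a ℤ.+ y ℤ.* (x ℤ.* b)
  distribute = solve-∀
  expand : ∀ x → x ℤ.* e' x ≡ x ℤ.* esymErase (suc k) xs x ℤ.+ y ℤ.* (x ℤ.* esymErase k xs x)
  expand x = trans (cong (x ℤ.*_) (esymErase-∷ k y xs x)) (distribute x _ y _)
  collect : ∀ y k a b → y ℤ.* a ℤ.+ ((1ℤ ℤ.+ k) ℤ.* b ℤ.+ y ℤ.* (k ℤ.* a)) ≡ (1ℤ ℤ.+ k) ℤ.* (b ℤ.+ y ℤ.* a)
  collect = solve-∀

esym-zero : ∀ k xs → length xs < k → esym k xs ≡ 0ℤ
esym-zero (suc k) []       _         = refl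
esym-zero (suc k) (x ∷ xs) (s≤s l<k) = cong₂ ℤ._+_ (esym-zero (suc k) xs (ℕ.m≤n⇒m≤1+n l<k))
  (trans (cong (x ℤ.*_) (esym-zero k xs l<k)) (ℤ.*-zeroʳ x))

-- Hence esymErase (length xs) xs x = ∏ (y - x) over y in xs.
esymErase-length : ∀ y xs x → esymErase (length (y ∷ xs)) (y ∷ xs) x ≡ (y ℤ.- x) ℤ.* esymErase (length xs) xs x
esymErase-length y xs x = begin
  esymErase (suc l) (y ∷ xs) x                                  ≡⟨ esymErase-∷ l y xs x ⟩
  (esym (suc l) xs ℤ.- x ℤ.* d) ℤ.+ y ℤ.* d
    ≡⟨ cong (λ e → (e ℤ.- x ℤ.* d) ℤ.+ y ℤ.* d) (esym-zero (suc l) xs ℕ.≤-refl) ⟩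
  (0ℤ ℤ.- x ℤ.* d) ℤ.+ y ℤ.* d                                  ≡⟨ lemma x y d ⟩
  (y ℤ.- x) ℤ.* d                                               ∎
  where
  open ≡-Reasoning
  l = length xs
  d = esymErase l xs x
  lemma : ∀ x y d → (0ℤ ℤ.- x ℤ.* d) ℤ.+ y ℤ.* d ≡ (y ℤ.- x) ℤ.* d
  lemma = solve-∀

∈⇒root : ∀ {x xs} → x ∈ xs → esymErase (length xs) xs x ≡ 0ℤ
∈⇒root {x} {y ∷ xs} (here x≡y) = trans (esymErase-length y xs x)
  (cong (ℤ._* esymErase (length xs) xs x) (ℤ.i≡j⇒i-j≡0 (sym x≡y)))
∈⇒root {x} {y ∷ xs} (there x∈) = trans (esymErase-length y xs x)
  (trans (cong ((y ℤ.- x) ℤ.*_) (∈⇒root x∈)) (ℤ.*-zeroʳ (y ℤ.- x)))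

-- ℤ has no zero divisors, so a vanishing ∏ (y - x) has a vanishing factor; the empty product is 1.
root⇒∈ : ∀ {x} xs → esymErase (length xs) xs x ≡ 0ℤ → x ∈ xs
root⇒∈ []           ()
root⇒∈ {x} (y ∷ xs) eq with ℤ.i*j≡0⇒i≡0∨j≡0 (y ℤ.- x) (trans (sym (esymErase-length y xs x)) eq)
... | inj₁ y-x≡0 = here (sym (ℤ.i-j≡0⇒i≡j y x y-x≡0))
... | inj₂ d≡0   = there (root⇒∈ xs d≡0)

-- Multisets with equal power sums

-- Tested against every function of degree < n instead of powers alone, so that the whole summand of
-- `newton` can serve as one test function.
record EqualMoments (n : ℕ) (X Y : List ℕ) : Set where
  constructor equalMoments
  field
    ∑-≡ : ∀ f → DegreeBelow n f → ∑ X f ≡ ∑ Y f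

open EqualMoments

esymErase-DegreeBelow : ∀ k xs → DegreeBelow (suc k) (λ i → esymErase k xs (+ i))
esymErase-DegreeBelow zero    xs = DegreeBelow-const 1ℤ
esymErase-DegreeBelow (suc k) xs = DegreeBelow-+ (DegreeBelow-const (esym (suc k) xs))
  (DegreeBelow-neg (DegreeBelow-id* (esymErase-DegreeBelow k xs)))

esymErase-cong : ∀ k {xs ys} → (∀ j → j ≤ k → esym j xs ≡ esym j ys) → esymErase k xs ≗ esymErase k ys
esymErase-cong zero    eq x = refl
esymErase-cong (suc k) eq x = cong₂ (λ e d → e ℤ.- x ℤ.* d) (eq (suc k) ℕ.≤-refl)
  (esymErase-cong k (λ j j≤k → eq j (ℕ.m≤n⇒m≤1+n j≤k)) x)

-- Strong induction on the degree, hence the bound `j ≤ k`. By `newton`, the next elementary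
-- symmetric function is, up to a nonzero factor, a sum of a polynomial whose coefficients involve
-- only the lower ones.
esym-equal : ∀ {X Y} → EqualMoments n X Y → ∀ k → k < n → ∀ j → j ≤ k → esym j (map +_ X) ≡ esym j (map +_ Y)
esym-equal em k       k<n zero    j≤k = refl
esym-equal em (suc k) k<n (suc j) j≤k with ℕ.m≤n⇒m<n∨m≡n j≤k
... | inj₁ (s≤s j<k) = esym-equal em k (ℕ.<-trans (ℕ.n<1+n k) k<n) (suc j) j<k
esym-equal {n} {X} {Y} em (suc k) k<n (suc j) j≤k | inj₂ refl =
  ℤ.*-cancelˡ-≡ (+ suc k) _ _ (begin
    + suc k ℤ.* esym (suc k) X⁺                            ≡⟨ newton k X⁺ ⟨
    ∑ X⁺ h                                                 ≡⟨ ∑-map +_ X h ⟩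
    -- `h` has degree at most k + 1, and `k<n` here reads `suc (suc k) ≤ n`.
    ∑ X (h ∘ +_)                                           ≡⟨ ∑-≡ em (h ∘ +_) (DegreeBelow-mono k<n (DegreeBelow-id* (esymErase-DegreeBelow k X⁺))) ⟩
    ∑ Y (h ∘ +_)                                           ≡⟨ ∑-map +_ Y h ⟨
    -- `h` is built from `X⁺`, but only through `esym i X⁺` with `i ≤ k`, where `X⁺` and `Y⁺`
    -- already agree.
    ∑ Y⁺ h                                                 ≡⟨ ∑-cong Y⁺ (λ x → cong (x ℤ.*_) (esymErase-cong k lower x)) ⟩
    ∑ Y⁺ (λ x → x ℤ.* esymErase k Y⁺ x)                    ≡⟨ newton k Y⁺ ⟩
    + suc k ℤ.* esym (suc k) Y⁺                            ∎)
  where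
  open ≡-Reasoning
  X⁺ = map +_ X
  Y⁺ = map +_ Y
  h : ℤ → ℤ
  h x = x ℤ.* esymErase k X⁺ x
  lower : ∀ i → i ≤ k → esym i X⁺ ≡ esym i Y⁺
  lower = esym-equal em k (ℕ.<-trans (ℕ.n<1+n k) k<n)

-- A positive degree bound admits the constant 1 as a test function, and its sum counts elements.
EqualMoments⇒length≡ : ∀ {X Y} → EqualMoments (suc n) X Y → length X ≡ length Y
EqualMoments⇒length≡ {n} {X} {Y} em =
  ℤ.+-injective (trans (sym (∑-1 X)) (trans (∑-≡ em (λ _ → 1ℤ) (DegreeBelow-const 1ℤ)) (∑-1 Y)))

-- Since `length X < n`, all coefficients of the polynomials ∏ (y - t) over X and over Y agree, so a
-- root of the first is a root of the second.
EqualMoments⇒⊆ : ∀ {X Y x} → EqualMoments n X Y → length X < n → length X ≡ length Y → x ∈ X → x ∈ Y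
EqualMoments⇒⊆ {n} {X} {Y} {x} em |X|<n |X|≡|Y| x∈X =
  let y , y∈Y , x≡y = ∈-map⁻ +_ (root⇒∈ Y⁺ root)
  in subst (_∈ Y) (sym (ℤ.+-injective x≡y)) y∈Y
  where
  open ≡-Reasoning
  X⁺ = map +_ X
  Y⁺ = map +_ Y
  root : esymErase (length Y⁺) Y⁺ (+ x) ≡ 0ℤ
  root = begin
    esymErase (length Y⁺) Y⁺ (+ x) ≡⟨ cong (λ l → esymErase l Y⁺ (+ x)) (trans (length-map +_ Y) (sym |X|≡|Y|)) ⟩
    esymErase (length X) Y⁺ (+ x)  ≡⟨ esymErase-cong (length X) (esym-equal em (length X) |X|<n) (+ x) ⟨
    esymErase (length X) X⁺ (+ x)  ≡⟨ cong (λ l → esymErase l X⁺ (+ x)) (length-map +_ X) ⟨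
    esymErase (length X⁺) X⁺ (+ x) ≡⟨ ∈⇒root (∈-map⁺ +_ x∈X) ⟩
    0ℤ                             ∎

disjoint⇒n≤length : ∀ {X Y} → X ≢ [] → (∀ {x} → x ∈ X → x ∈ Y → ⊥) →
  EqualMoments n X Y → length X ≡ length Y → n ≤ length X
disjoint⇒n≤length {n} {[]}    X≢[] _  _  _ = contradiction refl X≢[]
disjoint⇒n≤length {n} {x ∷ X} _ disjoint em |X|≡|Y| with n ℕ.≤? length (x ∷ X)
... | yes n≤|X| = n≤|X|
... | no  n≰|X| = contradiction (EqualMoments⇒⊆ em (ℕ.≰⇒> n≰|X|) |X|≡|Y| (here refl)) (disjoint (here refl))

-- Pairing a polynomial with a function on exponents

-- The linear functional sending zᵏ to `f k`. For a polynomial f it is the value at z = 1 of f(z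
-- d/dz) p.
pairing : ℤ[z] → (ℕ → ℤ) → ℤ
pairing []      f = 0ℤ
pairing (x ∷ p) f = x ℤ.* f 0 ℤ.+ pairing p (f ∘ suc)

pairing-≈0 : ∀ p f → p ≈ 0# → pairing p f ≡ 0ℤ
pairing-≈0 []      f p≈0 = refl
pairing-≈0 (x ∷ p) f p≈0 rewrite p≈0 0 | pairing-≈0 p (f ∘ suc) (p≈0 ∘ suc) = refl

pairing-cong : ∀ p q f → p ≈ q → pairing p f ≡ pairing q f
pairing-cong []      q       f p≈q = sym (pairing-≈0 q f (sym ∘ p≈q))
pairing-cong (x ∷ p) []      f p≈q = pairing-≈0 (x ∷ p) f p≈q
pairing-cong (x ∷ p) (y ∷ q) f p≈q = cong₂ (λ c s → c ℤ.* f 0 ℤ.+ s) (p≈q 0) (pairing-cong p q (f ∘ suc) (p≈q ∘ suc))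

pairing-+ : ∀ p q f → pairing (p + q) f ≡ pairing p f ℤ.+ pairing q f
pairing-+ []      q       f = sym (ℤ.+-identityˡ _)
pairing-+ (x ∷ p) []      f = sym (ℤ.+-identityʳ _)
pairing-+ (x ∷ p) (y ∷ q) f = trans (cong (λ s → (x ℤ.+ y) ℤ.* f 0 ℤ.+ s) (pairing-+ p q (f ∘ suc))) (lemma x y (f 0) _ _)
  where
  lemma : ∀ x y a s t → (x ℤ.+ y) ℤ.* a ℤ.+ (s ℤ.+ t) ≡ (x ℤ.* a ℤ.+ s) ℤ.+ (y ℤ.* a ℤ.+ t)
  lemma = solve-∀

pairing-scale : ∀ c p f → pairing (map (c ℤ.*_) p) f ≡ c ℤ.* pairing p f
pairing-scale c []      f = sym (ℤ.*-zeroʳ c)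
pairing-scale c (x ∷ p) f = trans (cong (λ s → (c ℤ.* x) ℤ.* f 0 ℤ.+ s) (pairing-scale c p (f ∘ suc))) (lemma c x (f 0) _)
  where
  lemma : ∀ c x a s → (c ℤ.* x) ℤ.* a ℤ.+ c ℤ.* s ≡ c ℤ.* (x ℤ.* a ℤ.+ s)
  lemma = solve-∀

-- Multiplication by z acts on test functions as the shift `f ∘ suc`.
pairing-∷* : ∀ x p q f → pairing ((x ∷ p) * q) f ≡ x ℤ.* pairing q f ℤ.+ pairing (p * q) (f ∘ suc)
pairing-∷* x p q f = trans (pairing-+ (map (x ℤ.*_) q) (0ℤ ∷ p * q) f)
  (cong₂ ℤ._+_ (pairing-scale x q f)
    (trans (cong (ℤ._+ pairing (p * q) (f ∘ suc)) (ℤ.*-zeroˡ (f 0))) (ℤ.+-identityˡ _)))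

indicator : ℕ → ℕ → ℤ
indicator zero    zero    = 1ℤ
indicator zero    (suc i) = 0ℤ
indicator (suc k) zero    = 0ℤ
indicator (suc k) (suc i) = indicator k i

pairing-zero : ∀ p → pairing p (λ _ → 0ℤ) ≡ 0ℤ
pairing-zero []      = refl
pairing-zero (x ∷ p) = cong₂ ℤ._+_ (ℤ.*-zeroʳ x) (pairing-zero p)

-- Allows a polynomial to be recognised as zero from its pairings alone.
coeff-pairing : ∀ p k → coeff p k ≡ pairing p (indicator k)
coeff-pairing []      k       = refl
coeff-pairing (x ∷ p) zero    = sym (trans (cong₂ ℤ._+_ (ℤ.*-identityʳ x) (pairing-zero p)) (ℤ.+-identityʳ x))
coeff-pairing (x ∷ p) (suc k) = trans (coeff-pairing p k)
  (sym (trans (cong (ℤ._+ pairing p (indicator k)) (ℤ.*-zeroʳ x)) (ℤ.+-identityˡ _)))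

pairing-z^ : ∀ k f → pairing (z ^ k) f ≡ f k
pairing-z^ zero    f = trans (ℤ.+-identityʳ _) (ℤ.*-identityˡ (f 0))
pairing-z^ (suc k) f = begin
  pairing (z * z ^ k) f                                                ≡⟨ pairing-∷* 0ℤ (1ℤ ∷ []) (z ^ k) f ⟩
  0ℤ ℤ.* pairing (z ^ k) f ℤ.+ pairing ((1ℤ ∷ []) * z ^ k) (f ∘ suc)   ≡⟨ cong₂ ℤ._+_ (ℤ.*-zeroˡ (pairing (z ^ k) f)) (pairing-∷* 1ℤ [] (z ^ k) (f ∘ suc)) ⟩
  0ℤ ℤ.+ (1ℤ ℤ.* pairing (z ^ k) (f ∘ suc) ℤ.+ 0ℤ)                     ≡⟨ lemma _ ⟩
  pairing (z ^ k) (f ∘ suc)                                            ≡⟨ pairing-z^ k (f ∘ suc) ⟩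
  f (suc k)                                                            ∎
  where
  open ≡-Reasoning
  lemma : ∀ a → 0ℤ ℤ.+ (1ℤ ℤ.* a ℤ.+ 0ℤ) ≡ a
  lemma = solve-∀

pairing-monomial : ∀ c k f → pairing (const c * z ^ k) f ≡ c ℤ.* f k
pairing-monomial c k f = trans (pairing-∷* c [] (z ^ k) f)
  (trans (ℤ.+-identityʳ _) (cong (c ℤ.*_) (pairing-z^ k f)))

-- Divisibility by powers of 1 - z, in dual form

record Annihilates (n : ℕ) (p : ℤ[z]) : Set where
  constructor annihilates
  field
    pairing-≡0 : ∀ f → DegreeBelow n f → pairing p f ≡ 0ℤ

open Annihilates

-- Functions of degree < n are closed under the shift, which is dual to multiplication by z.
Annihilates-* : ∀ q {p} → Annihilates n p → Annihilates n (q * p)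
Annihilates-* []          ann = annihilates λ _ _ → refl
Annihilates-* (x ∷ q) {p} ann = annihilates λ f d → trans (pairing-∷* x q p f)
  (cong₂ ℤ._+_ (trans (cong (x ℤ.*_) (pairing-≡0 ann f d)) (ℤ.*-zeroʳ x))
    (pairing-≡0 (Annihilates-* q ann) (f ∘ suc) (DegreeBelow-shift d)))

pairing-Δ : ∀ p f → pairing p (Δ f) ≡ pairing p (f ∘ suc) ℤ.- pairing p f
pairing-Δ []      f = refl
pairing-Δ (x ∷ p) f = trans (cong (λ s → x ℤ.* Δ f 0 ℤ.+ s) (pairing-Δ p (f ∘ suc))) (lemma x (f 1) (f 0) _ _)
  where
  lemma : ∀ x a b s t → x ℤ.* (a ℤ.- b) ℤ.+ (s ℤ.- t) ≡ (x ℤ.* a ℤ.+ s) ℤ.- (x ℤ.* b ℤ.+ t)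
  lemma = solve-∀

-- Multiplication by z is adjoint to the shift, so multiplication by 1 - z is adjoint to identity
-- minus shift.
pairing-[1-z]* : ∀ p f → pairing ((1# + - z) * p) f ≡ ℤ.- pairing p (Δ f)
pairing-[1-z]* p f = begin
  pairing ((1# + - z) * p) f
    ≡⟨ pairing-∷* 1ℤ (-1ℤ ∷ []) p f ⟩
  1ℤ ℤ.* pairing p f ℤ.+ pairing ((-1ℤ ∷ []) * p) (f ∘ suc)
    ≡⟨ cong (λ s → 1ℤ ℤ.* pairing p f ℤ.+ s) (pairing-∷* -1ℤ [] p (f ∘ suc)) ⟩
  1ℤ ℤ.* pairing p f ℤ.+ (-1ℤ ℤ.* pairing p (f ∘ suc) ℤ.+ 0ℤ)
    ≡⟨ lemma (pairing p f) (pairing p (f ∘ suc)) ⟩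
  ℤ.- (pairing p (f ∘ suc) ℤ.- pairing p f)
    ≡⟨ cong ℤ.-_ (pairing-Δ p f) ⟨
  ℤ.- pairing p (Δ f) ∎
  where
  open ≡-Reasoning
  lemma : ∀ a b → 1ℤ ℤ.* a ℤ.+ (-1ℤ ℤ.* b ℤ.+ 0ℤ) ≡ ℤ.- (b ℤ.- a)
  lemma = solve-∀

-- Each factor 1 - z moves one difference onto f, and n differences reduce f to zero.
Annihilates-[1-z]^ : ∀ n → Annihilates n ((1# + - z) ^ n)
Annihilates-[1-z]^ zero    = annihilates λ where
  f (zeros f≗0) → trans (ℤ.+-identityʳ _) (trans (ℤ.*-identityˡ (f 0)) (f≗0 0))
Annihilates-[1-z]^ (suc n) = annihilates λ where
  f (diff d) → trans (pairing-[1-z]* ((1# + - z) ^ n) f)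
    (cong ℤ.-_ (pairing-≡0 (Annihilates-[1-z]^ n) (Δ f) d))

-- Multisets of exponents

bag : Vector ℕ m → Vector A m → List A
bag c g = concat (tabulate λ k → replicate (c k) (g k))

∈-replicate⇒ : ∀ c {x y : A} → x ∈ replicate c y → c ≢ 0 × x ≡ y
∈-replicate⇒ (suc c) (here x≡y) = (λ ()) , x≡y
∈-replicate⇒ (suc c) (there x∈) = (λ ()) , proj₂ (∈-replicate⇒ c x∈)

∈-bag⇒ : ∀ (c : Vector ℕ m) (g : Vector A m) {x} → x ∈ bag c g → ∃ λ k → c k ≢ 0 × x ≡ g k
∈-bag⇒ c g x∈ with k , x∈k ← Any.tabulate⁻ (Any.concat⁻ (tabulate λ k → replicate (c k) (g k)) x∈) =
  k , ∈-replicate⇒ (c k) x∈k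

_⁺ : ℤ → ℕ
(+ n)    ⁺ = n
-[1+ n ] ⁺ = 0

_⁻ : ℤ → ℕ
i ⁻ = (ℤ.- i) ⁺

⁺-⁻ : ∀ i → + (i ⁺) ℤ.- + (i ⁻) ≡ i
⁺-⁻ (+ zero)  = refl
⁺-⁻ +[1+ n ]  = ℤ.+-identityʳ _
⁺-⁻ -[1+ n ]  = refl

⁺≢0⇒⁻≡0 : ∀ i → i ⁺ ≢ 0 → i ⁻ ≡ 0
⁺≢0⇒⁻≡0 (+ zero) i⁺≢0 = refl
⁺≢0⇒⁻≡0 +[1+ n ] i⁺≢0 = refl
⁺≢0⇒⁻≡0 -[1+ n ] i⁺≢0 = contradiction refl i⁺≢0

⁺+⁻ : ∀ i → i ⁺ ℕ.+ i ⁻ ≡ ∣ i ∣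
⁺+⁻ (+ zero) = refl
⁺+⁻ +[1+ n ] = ℕ.+-identityʳ _
⁺+⁻ -[1+ n ] = refl

m≤m^2 : ∀ m → m ≤ m ℕ.^ 2
m≤m^2 zero    = z≤n
m≤m^2 (suc m) = ℕ.m≤m*n (suc m) (suc m ℕ.^ 1)

-- The exponents `g` are arbitrary because the recursion replaces `toℕ` by `toℕ ∘ Fin.suc`.
pairing-bags : ∀ (a : Vector ℤ m) (g : Vector ℕ m) f →
  pairing (sumₚ (λ k → const (a k) * z ^ g k)) f ≡ ∑ (bag (_⁺ ∘ a) g) f ℤ.- ∑ (bag (_⁻ ∘ a) g) f
pairing-bags {zero}  a g f = refl
pairing-bags {suc m} a g f = begin
  pairing (const a₀ * z ^ g₀ + sumₚ (λ k → const (a (Fin.suc k)) * z ^ g (Fin.suc k))) f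
    ≡⟨ pairing-+ (const a₀ * z ^ g₀) _ f ⟩
  pairing (const a₀ * z ^ g₀) f ℤ.+ pairing (sumₚ (λ k → const (a (Fin.suc k)) * z ^ g (Fin.suc k))) f
    ≡⟨ cong₂ ℤ._+_ (pairing-monomial a₀ g₀ f) (pairing-bags (a ∘ Fin.suc) (g ∘ Fin.suc) f) ⟩
  a₀ ℤ.* f g₀ ℤ.+ (∑ R⁺ f ℤ.- ∑ R⁻ f)
    ≡⟨ cong (λ i → i ℤ.* f g₀ ℤ.+ (∑ R⁺ f ℤ.- ∑ R⁻ f)) (⁺-⁻ a₀) ⟨
  (+ (a₀ ⁺) ℤ.- + (a₀ ⁻)) ℤ.* f g₀ ℤ.+ (∑ R⁺ f ℤ.- ∑ R⁻ f)
    ≡⟨ lemma (+ (a₀ ⁺)) (+ (a₀ ⁻)) (f g₀) (∑ R⁺ f) (∑ R⁻ f) ⟩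
  (+ (a₀ ⁺) ℤ.* f g₀ ℤ.+ ∑ R⁺ f) ℤ.- (+ (a₀ ⁻) ℤ.* f g₀ ℤ.+ ∑ R⁻ f)
    ≡⟨ cong₂ ℤ._-_ (∑-block (a₀ ⁺) R⁺) (∑-block (a₀ ⁻) R⁻) ⟨
  ∑ (bag (_⁺ ∘ a) g) f ℤ.- ∑ (bag (_⁻ ∘ a) g) f ∎
  where
  open ≡-Reasoning
  a₀ = a Fin.zero
  g₀ = g Fin.zero
  R⁺ = bag (_⁺ ∘ a ∘ Fin.suc) (g ∘ Fin.suc)
  R⁻ = bag (_⁻ ∘ a ∘ Fin.suc) (g ∘ Fin.suc)
  ∑-block : ∀ c R → ∑ (replicate c g₀ ++ R) f ≡ + c ℤ.* f g₀ ℤ.+ ∑ R f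
  ∑-block c R = trans (∑-++ (replicate c g₀) R f) (cong (ℤ._+ ∑ R f) (∑-replicate c g₀ f))
  lemma : ∀ p q x s t → (p ℤ.- q) ℤ.* x ℤ.+ (s ℤ.- t) ≡ (p ℤ.* x ℤ.+ s) ℤ.- (q ℤ.* x ℤ.+ t)
  lemma = solve-∀

-- The two lengths add up to ∑ |aₖ|, and m ≤ m² for every natural number m.
length-bags≤ : ∀ (a : Vector ℤ m) (g : Vector A m) →
  length (bag (_⁺ ∘ a) g) ℕ.+ length (bag (_⁻ ∘ a) g) ≤ sumℕ (λ k → ∣ a k ∣ ℕ.^ 2)
length-bags≤ {zero}  a g = z≤n
length-bags≤ {suc m} a g = begin
  length (bag (_⁺ ∘ a) g) ℕ.+ length (bag (_⁻ ∘ a) g)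
    ≡⟨ cong₂ ℕ._+_ (length-block (a₀ ⁺) R⁺) (length-block (a₀ ⁻) R⁻) ⟩
  (a₀ ⁺ ℕ.+ length R⁺) ℕ.+ (a₀ ⁻ ℕ.+ length R⁻)
    ≡⟨ interchange (a₀ ⁺) (length R⁺) (a₀ ⁻) (length R⁻) ⟩
  (a₀ ⁺ ℕ.+ a₀ ⁻) ℕ.+ (length R⁺ ℕ.+ length R⁻)
    ≡⟨ cong (ℕ._+ (length R⁺ ℕ.+ length R⁻)) (⁺+⁻ a₀) ⟩
  ∣ a₀ ∣ ℕ.+ (length R⁺ ℕ.+ length R⁻)
    ≤⟨ ℕ.+-mono-≤ (m≤m^2 ∣ a₀ ∣) (length-bags≤ (a ∘ Fin.suc) (g ∘ Fin.suc)) ⟩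
  sumℕ (λ k → ∣ a k ∣ ℕ.^ 2) ∎
  where
  open ℕ.≤-Reasoning
  a₀ = a Fin.zero
  g₀ = g Fin.zero
  R⁺ = bag (_⁺ ∘ a ∘ Fin.suc) (g ∘ Fin.suc)
  R⁻ = bag (_⁻ ∘ a ∘ Fin.suc) (g ∘ Fin.suc)
  length-block : ∀ c R → length (replicate c g₀ ++ R) ≡ c ℕ.+ length R
  length-block c R = trans (length-++ (replicate c g₀)) (cong (ℕ._+ length R) (length-replicate c))

theorem3p2 : (n : ℕ) → 1 ≤ n → (N : ℕ) (a : Vector ℤ (suc N)) →
    polynomial a ≉ 0# →
    (1# + - z) ^ n ∣ polynomial a →
    sumℕ (λ k → ∣ a k ∣ ℕ.^ 2) ≥ 2 ℕ.* n
theorem3p2 n@(suc n-1) 1≤n N a p≉0 (q , q*[1-z]^n≈p) = begin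
  2 ℕ.* n                      ≡⟨ cong (n ℕ.+_) (ℕ.+-identityʳ n) ⟩
  n ℕ.+ n                      ≤⟨ ℕ.+-mono-≤ n≤|X| (subst (n ≤_) |X|≡|Y| n≤|X|) ⟩
  length X ℕ.+ length Y        ≤⟨ length-bags≤ a toℕ ⟩
  sumℕ (λ k → ∣ a k ∣ ℕ.^ 2)   ∎
  where
  open ℕ.≤-Reasoning
  X = bag (_⁺ ∘ a) toℕ
  Y = bag (_⁻ ∘ a) toℕ

  em : EqualMoments n X Y
  -- The difference of the two sums is the pairing of f with a multiple of (1 - z)ⁿ, which vanishes.
  em = equalMoments λ f d → ℤ.i-j≡0⇒i≡j (∑ X f) (∑ Y f) (trans (sym (pairing-bags a toℕ f))
    (trans (sym (pairing-cong (q * (1# + - z) ^ n) (polynomial a) f q*[1-z]^n≈p))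
      (pairing-≡0 (Annihilates-* q (Annihilates-[1-z]^ n)) f d)))

  |X|≡|Y| : length X ≡ length Y
  |X|≡|Y| = EqualMoments⇒length≡ em

  X≢[] : X ≢ []
  -- If X is empty, so is Y by equality of lengths; then every pairing vanishes, in particular those
  -- that read off coefficients.
  X≢[] X≡[] = p≉0 λ k → trans (coeff-pairing (polynomial a) k)
    (trans (pairing-bags a toℕ (indicator k))
      (cong₂ (λ U V → ∑ U (indicator k) ℤ.- ∑ V (indicator k)) X≡[] Y≡[]))
    where
    Y≡[] : Y ≡ []
    Y≡[] with Y | trans (sym |X|≡|Y|) (cong length X≡[])
    ... | [] | _ = refl

  disjoint : ∀ {x} → x ∈ X → x ∈ Y → ⊥
  disjoint x∈X x∈Y
    -- A common exponent comes from one index, by injectivity of `toℕ`; its coefficient would have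
    -- nonzero positive and negative parts.
    with j , a⁺≢0 , refl ← ∈-bag⇒ (_⁺ ∘ a) toℕ x∈X
    with k , a⁻≢0 , j≡k ← ∈-bag⇒ (_⁻ ∘ a) toℕ x∈Y
    with refl ← toℕ-injective j≡k = a⁻≢0 (⁺≢0⇒⁻≡0 (a j) a⁺≢0)

  n≤|X| : n ≤ length X
  n≤|X| = disjoint⇒n≤length X≢[] disjoint em |X|≡|Y|
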